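{- Let $P$ be a finite poset. For every $f\in\mathcal O(P)$ we have $\alpha_2(f)\in\mathcal C(P)$, $\alpha_3(\alpha_2(f))\in\tilde{\mathcal O}(P)$, and $$\rho_{\mathcal P}(f)=\alpha_1\bigl(\alpha_3(\alpha_2(f))\bigr),$$ i.e. $\rho_{\mathcal P}=\alpha_1\circ\alpha_3\circ\alpha_2$ on $\mathcal O(P)$.
   Context: For a finite poset $P$, let $\widehat P=P\cup\{\hat0,\hat1\}$ with $\hat0<x<\hat1$ for all $x\in P$, and write $y\lessdot x$ ($x$ covers $y$) when $y<x$ and no $z$ satisfies $y<z<x$. The order polytope $\mathcal O(P)$ is the set of order-preserving maps $f:P\to[0,1]$; each such $f$ is extended to $\hat f$ on $\widehat P$ by $\hat f(\hat0)=0$, $\hat f(\hat1)=1$. For $x\in P$ the piecewise-linear toggle $\tau_x:\mathcal O(P)\to\mathcal O(P)$ leaves $f(y)$ unchanged for $y\neq x$ and sets $(\tau_xf)(x)=\max\{\hat f(y):y\in\widehat P,\ y\lessdot x\}+\min\{\hat f(y):y\in\widehat P,\ y\gtrdot x\}-f(x)$. Piecewise-linear rowmotion is $\rho_{\mathcal P}=\tau_{x_1}\circ\cdots\circ\tau_{x_p}$ for any linear extension $x_1,\dots,x_p$ of $P$. The chain polytope $\mathcal C(P)$ is the set of maps $g:P\to[0,1]$ with $\sum_{x\in C}g(x)\le 1$ for every chain $C\subseteq P$. $\tilde{\mathcal O}(P)$ is the set of order-reversing maps $P\to[0,1]$. Define: $(\alpha_1 h)(x)=1-h(x)$ for $h\in\tilde{\mathcal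 O}(P)$; $(\alpha_2 f)(x)=\min\{\hat f(x)-\hat f(y): y\in\widehat P,\ y\lessdot x\}$ for $f\in\mathcal O(P)$; and $(\alpha_3 g)(x)=\max\{g(y_1)+\cdots+g(y_k): x=y_1\lessdot y_2\lessdot\cdots\lessdot y_k\lessdot\hat1,\ y_1,\dots,y_k\in P\}$ for $g\in\mathcal C(P)$. -}

module Defs where

open import Data.List.Base using (List; []; _∷_; _++_; map; foldr; filter; concatMap; length)
open import Data.List.Membership.Propositional using (_∈_)
open import Data.List.Membership.Propositional.Properties using (∈-map⁺)
import Data.List.Relation.Unary.Any as Any
open Any using (here; there; any?)
open import Data.List.Relation.Unary.AllPairs using (AllPairs)
import Data.List.Relation.Unary.Enumerates.Setoid as Enumerates
open import Data.List.Relation.Unary.Linked using (linked?)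
open import Data.List.Relation.Unary.Unique.Propositional using (Unique)
import Data.Nat.Base as ℕ
open ℕ using (ℕ; zero; suc)
import Data.Nat.Properties as ℕ
open import Data.Product.Base using (∃-syntax; _×_; _,_)
import Data.Rational.Base as ℚ
open ℚ using (ℚ; 0ℚ; 1ℚ; ½)
import Data.Rational.Properties as ℚ
open import Data.Rational.Solver using (module +-*-Solver)
open import Data.Sum.Base using (_⊎_; inj₁; inj₂)
open import Level using (0ℓ)
open import Relation.Binary.Core using (Rel)
open import Relation.Binary.Definitions using (Decidable)
import Relation.Binary.Construct.Add.Extrema.Strict as AddExtrema
import Relation.Binary.Construct.NonStrictToStrict as ToStrict
open import Relation.Binary.PropositionalEquality
  using (_≡_; refl; sym; cong; subst; subst₂; setoid)
open import Relation.Binary.Structures using (IsDecPartialOrder)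
open import Relation.Nullary using (¬_; yes; no; ¬?)
open import Relation.Nullary.Construct.Add.Extrema using (_±; ⊥±; ⊤±; [_])
open import Relation.Nullary.Decidable using (map′; _×-dec_)
open import Relation.Unary using (Pred)

-- The reals are Cauchy sequences of rationals, with _≃_ as equality.  All
-- operations act termwise.

IsCauchy : (ℕ → ℚ) → Set
IsCauchy s = ∀ ε → 0ℚ ℚ.< ε →
  ∃[ N ] ∀ m n → N ℕ.≤ m → N ℕ.≤ n → ℚ.∣ s m ℚ.- s n ∣ ℚ.≤ ε

record ℝ : Set where
  constructor mkℝ
  field
    seq    : ℕ → ℚ
    cauchy : IsCauchy seq

open ℝ public

infix 4 _≃_ _≤_

record _≃_ (x y : ℝ) : Set where
  constructor mk≃
  field
    eventually-close : ∀ ε → 0ℚ ℚ.< ε →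
      ∃[ N ] ∀ n → N ℕ.≤ n → ℚ.∣ seq x n ℚ.- seq y n ∣ ℚ.≤ ε

record _≤_ (x y : ℝ) : Set where
  constructor mk≤
  field
    eventually-≤+ε : ∀ ε → 0ℚ ℚ.< ε →
      ∃[ N ] ∀ n → N ℕ.≤ n → seq x n ℚ.≤ seq y n ℚ.+ ε

∣p-q∣≤ε⇒p≤q+ε : ∀ p q {ε} → ℚ.∣ p ℚ.- q ∣ ℚ.≤ ε → p ℚ.≤ q ℚ.+ ε
∣p-q∣≤ε⇒p≤q+ε p q {ε} h =
  subst (ℚ._≤ q ℚ.+ ε)
    (solve 2 (λ a b → b :+ (a :- b) := a) refl p q)
    (ℚ.+-monoʳ-≤ q (ℚ.≤-trans (p≤∣p∣ (p ℚ.- q)) h))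
  where
  open +-*-Solver
  p≤∣p∣ : ∀ r → r ℚ.≤ ℚ.∣ r ∣
  p≤∣p∣ r with ℚ.≤-total 0ℚ r
  ... | inj₁ 0≤r = ℚ.≤-reflexive (sym (ℚ.0≤p⇒∣p∣≡p 0≤r))
  ... | inj₂ r≤0 = ℚ.≤-trans r≤0 (ℚ.0≤∣p∣ r)

∣p-q∣≡∣q-p∣ : ∀ p q → ℚ.∣ p ℚ.- q ∣ ≡ ℚ.∣ q ℚ.- p ∣
∣p-q∣≡∣q-p∣ p q rewrite sym (ℚ.∣-p∣≡∣p∣ (p ℚ.- q)) =
  cong ℚ.∣_∣ (solve 2 (λ a b → :- (a :- b) := b :- a) refl p q)
  where open +-*-Solver

∣p-q∣≤ε⇒q≤p+ε : ∀ p q {ε} → ℚ.∣ p ℚ.- q ∣ ℚ.≤ ε → q ℚ.≤ p ℚ.+ ε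
∣p-q∣≤ε⇒q≤p+ε p q {ε} h =
  ∣p-q∣≤ε⇒p≤q+ε q p (subst (ℚ._≤ ε) (∣p-q∣≡∣q-p∣ p q) h)

p≤q+ε⇒p-q≤ε : ∀ p q {ε} → p ℚ.≤ q ℚ.+ ε → p ℚ.- q ℚ.≤ ε
p≤q+ε⇒p-q≤ε p q {ε} h =
  subst (p ℚ.- q ℚ.≤_)
    (solve 2 (λ b e → (b :+ e) :- b := e) refl q ε)
    (ℚ.+-monoˡ-≤ (ℚ.- q) h)
  where open +-*-Solver

≤+ε⇒∣p-q∣≤ε : ∀ p q {ε} → p ℚ.≤ q ℚ.+ ε → q ℚ.≤ p ℚ.+ ε → ℚ.∣ p ℚ.- q ∣ ℚ.≤ ε
≤+ε⇒∣p-q∣≤ε p q {ε} h k with ℚ.∣p∣≡p∨∣p∣≡-p (p ℚ.- q)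
... | inj₁ eq = subst (ℚ._≤ ε) (sym eq) (p≤q+ε⇒p-q≤ε p q h)
... | inj₂ eq = subst (ℚ._≤ ε) (sym eq)
  (subst (ℚ._≤ ε) (solve 2 (λ a b → b :- a := :- (a :- b)) refl p q)
    (p≤q+ε⇒p-q≤ε q p k))
  where open +-*-Solver

-- Combine two Cauchy sequences by an operation that does not increase
-- the sup-distance.
cauchy₂ : (_∙_ : ℚ → ℚ → ℚ) →
          (∀ p q r s {ε} → p ℚ.≤ r ℚ.+ ε → q ℚ.≤ s ℚ.+ ε → (p ∙ q) ℚ.≤ (r ∙ s) ℚ.+ ε) →
          ∀ s t → IsCauchy s → IsCauchy t → IsCauchy (λ n → s n ∙ t n)
cauchy₂ _∙_ lip s t cs ct ε 0<ε with cs ε 0<ε | ct ε 0<ε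
... | M , hs | N , ht = M ℕ.⊔ N , λ m n km kn →
  let a = hs m n (ℕ.m⊔n≤o⇒m≤o M N km) (ℕ.m⊔n≤o⇒m≤o M N kn)
      b = ht m n (ℕ.m⊔n≤o⇒n≤o M N km) (ℕ.m⊔n≤o⇒n≤o M N kn)
  in ≤+ε⇒∣p-q∣≤ε _ _
       (lip _ _ _ _ (∣p-q∣≤ε⇒p≤q+ε (s m) (s n) a) (∣p-q∣≤ε⇒p≤q+ε (t m) (t n) b))
       (lip _ _ _ _ (∣p-q∣≤ε⇒q≤p+ε (s m) (s n) a) (∣p-q∣≤ε⇒q≤p+ε (t m) (t n) b))

⊔-lip : ∀ p q r s {ε} → p ℚ.≤ r ℚ.+ ε → q ℚ.≤ s ℚ.+ ε → p ℚ.⊔ q ℚ.≤ (r ℚ.⊔ s) ℚ.+ ε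
⊔-lip p q r s {ε} h k = ℚ.⊔-lub
  (ℚ.≤-trans h (ℚ.+-monoˡ-≤ ε (ℚ.p≤p⊔q r s)))
  (ℚ.≤-trans k (ℚ.+-monoˡ-≤ ε (ℚ.p≤q⊔p r s)))

⊓-lip : ∀ p q r s {ε} → p ℚ.≤ r ℚ.+ ε → q ℚ.≤ s ℚ.+ ε → p ℚ.⊓ q ℚ.≤ (r ℚ.⊓ s) ℚ.+ ε
⊓-lip p q r s {ε} h k =
  subst (p ℚ.⊓ q ℚ.≤_)
    (sym (ℚ.mono-≤-distrib-⊓ {ℚ._+ ε} (ℚ.+-monoˡ-≤ ε) r s))
    (ℚ.⊓-mono-≤ h k)

0<½*ε : ∀ {ε} → 0ℚ ℚ.< ε → 0ℚ ℚ.< ½ ℚ.* ε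
0<½*ε = ℚ.*-monoʳ-<-pos ½

cauchy-+ : ∀ s t → IsCauchy s → IsCauchy t → IsCauchy (λ n → s n ℚ.+ t n)
cauchy-+ s t cs ct ε 0<ε with cs (½ ℚ.* ε) (0<½*ε 0<ε) | ct (½ ℚ.* ε) (0<½*ε 0<ε)
... | M , hs | N , ht = M ℕ.⊔ N , λ m n km kn →
  subst₂ ℚ._≤_
    (cong ℚ.∣_∣ (solve 4 (λ a b c d → (a :- b) :+ (c :- d) := (a :+ c) :- (b :+ d))
      refl (s m) (s n) (t m) (t n)))
    (solve 1 (λ e → con ½ :* e :+ con ½ :* e := e) refl ε)
    (ℚ.≤-trans (ℚ.∣p+q∣≤∣p∣+∣q∣ (s m ℚ.- s n) (t m ℚ.- t n))
      (ℚ.+-mono-≤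
        (hs m n (ℕ.m⊔n≤o⇒m≤o M N km) (ℕ.m⊔n≤o⇒m≤o M N kn))
        (ht m n (ℕ.m⊔n≤o⇒n≤o M N km) (ℕ.m⊔n≤o⇒n≤o M N kn))))
  where open +-*-Solver

cauchy-neg : ∀ s → IsCauchy s → IsCauchy (λ n → ℚ.- s n)
cauchy-neg s cs ε 0<ε with cs ε 0<ε
... | N , h = N , λ m n km kn →
  subst (λ z → ℚ.∣ z ∣ ℚ.≤ ε)
    (solve 2 (λ a b → b :- a := (:- a) :- (:- b)) refl (s m) (s n))
    (h n m kn km)
  where open +-*-Solver

fromℚ : ℚ → ℝ
fromℚ q = mkℝ (λ _ → q) λ ε 0<ε → 0 , λ _ _ _ _ →
  subst (λ z → ℚ.∣ z ∣ ℚ.≤ ε) (sym (ℚ.+-inverseʳ q)) (ℚ.<⇒≤ 0<ε)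

0ℝ 1ℝ : ℝ
0ℝ = fromℚ 0ℚ
1ℝ = fromℚ 1ℚ

infixl 6 _+_ _-_ _⊔_
infixl 7 _⊓_
infix  8 -_

_+_ : ℝ → ℝ → ℝ
x + y = mkℝ (λ n → seq x n ℚ.+ seq y n)
            (cauchy-+ (seq x) (seq y) (cauchy x) (cauchy y))

-_ : ℝ → ℝ
- x = mkℝ (λ n → ℚ.- seq x n) (cauchy-neg (seq x) (cauchy x))

_-_ : ℝ → ℝ → ℝ
x - y = x + (- y)

_⊔_ : ℝ → ℝ → ℝ
x ⊔ y = mkℝ (λ n → seq x n ℚ.⊔ seq y n)
            (cauchy₂ ℚ._⊔_ ⊔-lip (seq x) (seq y) (cauchy x) (cauchy y))

_⊓_ : ℝ → ℝ → ℝ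
x ⊓ y = mkℝ (λ n → seq x n ℚ.⊓ seq y n)
            (cauchy₂ ℚ._⊓_ ⊓-lip (seq x) (seq y) (cauchy x) (cauchy y))

-- The value at [] is a dummy: the sets of which a maximum or minimum is
-- taken below are never empty.
maximum : List ℝ → ℝ
maximum []           = 0ℝ
maximum (x ∷ [])     = x
maximum (x ∷ y ∷ xs) = x ⊔ maximum (y ∷ xs)

minimum : List ℝ → ℝ
minimum []           = 0ℝ
minimum (x ∷ [])     = x
minimum (x ∷ y ∷ xs) = x ⊓ minimum (y ∷ xs)

sum : List ℝ → ℝ
sum = foldr _+_ 0ℝ

record FinitePoset : Set₁ where
  infix 4 _⊑_
  field
    Carrier           : Set
    _⊑_               : Rel Carrier 0ℓ
    isDecPartialOrder : IsDecPartialOrder _≡_ _⊑_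
    elements          : List Carrier
    enumerates        : Enumerates.IsEnumeration (setoid Carrier) elements

  open IsDecPartialOrder isDecPartialOrder public using (_≟_) renaming (_≤?_ to _⊑?_)

module _ (P : FinitePoset) where
  open FinitePoset P

  infix 4 _⊏_ _⋖_ _⋖?_

  _⊏_ : Rel Carrier 0ℓ
  _⊏_ = ToStrict._<_ _≡_ _⊑_

  -- P̂ is Carrier ±, with 0̂ = ⊥± and 1̂ = ⊤±; the embedding of P is [_].
  P̂ : Set
  P̂ = Carrier ±

  open AddExtrema _⊏_ using (_<±_; <±-dec)

  _<±?_ : Decidable _<±_
  _<±?_ = <±-dec (ToStrict.<-decidable _≡_ _⊑_ _≟_ _⊑?_)

  _⋖_ : Rel P̂ 0ℓ
  y ⋖ x = y <± x × ¬ (∃[ z ] (y <± z × z <± x))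

  P̂-elements : List P̂
  P̂-elements = ⊥± ∷ ⊤± ∷ map [_] elements

  P̂-enumerates : Enumerates.IsEnumeration (setoid P̂) P̂-elements
  P̂-enumerates ⊥±    = here refl
  P̂-enumerates ⊤±    = there (here refl)
  P̂-enumerates [ x ] = there (there (∈-map⁺ [_] (enumerates x)))

  _⋖?_ : Decidable _⋖_
  y ⋖? x = (y <±? x) ×-dec ¬? (map′ Any.satisfied
    (λ (z , y<z<x) → Any.map (λ { refl → y<z<x }) (P̂-enumerates z))
    (any? (λ z → (y <±? z) ×-dec (z <±? x)) P̂-elements))

  lowerCovers upperCovers : P̂ → List P̂
  lowerCovers x = filter (λ y → y ⋖? x) P̂-elements
  upperCovers x = filter (λ y → x ⋖? y) P̂-elements

  -- A finite subset of P is represented by a duplicate-free list.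
  IsChain : Pred (List Carrier) 0ℓ
  IsChain C = Unique C × AllPairs (λ x y → x ⊑ y ⊎ y ⊑ x) C

  IsLinearExtension : Pred (List Carrier) 0ℓ
  IsLinearExtension xs =
    Unique xs × (∀ x → x ∈ xs) × AllPairs (λ x y → ¬ (y ⊏ x)) xs

  UnitInterval-valued : Pred (Carrier → ℝ) 0ℓ
  UnitInterval-valued f = ∀ x → 0ℝ ≤ f x × f x ≤ 1ℝ

  OrderPolytope : Pred (Carrier → ℝ) 0ℓ
  OrderPolytope f = UnitInterval-valued f × (∀ {x y} → x ⊑ y → f x ≤ f y)

  OrderReversing : Pred (Carrier → ℝ) 0ℓ
  OrderReversing h = UnitInterval-valued h × (∀ {x y} → x ⊑ y → h y ≤ h x)

  ChainPolytope : Pred (Carrier → ℝ) 0ℓ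
  ChainPolytope g = UnitInterval-valued g × (∀ C → IsChain C → sum (map g C) ≤ 1ℝ)

  hat : (Carrier → ℝ) → P̂ → ℝ
  hat f ⊥±    = 0ℝ
  hat f ⊤±    = 1ℝ
  hat f [ x ] = f x

  toggle : Carrier → (Carrier → ℝ) → Carrier → ℝ
  toggle x f y with y ≟ x
  ... | no  _ = f y
  ... | yes _ = maximum (map (hat f) (lowerCovers [ x ]))
              + minimum (map (hat f) (upperCovers [ x ]))
              - f x

  -- toggle x₁ ∘ ⋯ ∘ toggle xₚ: the last element of the list is toggled first.
  ρ : List Carrier → (Carrier → ℝ) → Carrier → ℝ
  ρ xs f = foldr toggle f xs

  α₁ : (Carrier → ℝ) → Carrier → ℝ
  α₁ h x = 1ℝ - h x

  α₂ : (Carrier → ℝ) → Carrier → ℝ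
  α₂ f x = minimum (map (λ y → hat f [ x ] - hat f y) (lowerCovers [ x ]))

  listsUpTo : ℕ → List (List Carrier)
  listsUpTo zero    = [] ∷ []
  listsUpTo (suc n) = [] ∷ concatMap (λ x → map (x ∷_) (listsUpTo n)) elements

  -- All saturated chains x = y₁ ⋖ ⋯ ⋖ yₖ ⋖ 1̂.  Such a chain has no repeated
  -- elements, so bounding the length of y₂ , … , yₖ by that of `elements`
  -- excludes none.
  saturatedChains : Carrier → List (List Carrier)
  saturatedChains x =
    filter (λ ys → linked? _⋖?_ (map [_] ys ++ ⊤± ∷ []))
      (map (x ∷_) (listsUpTo (length elements)))

  α₃ : (Carrier → ℝ) → Carrier → ℝ
  α₃ g x = maximum (map (λ ys → sum (map g ys)) (saturatedChains x))

{-# OPTIONS --safe #-}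

-- Put g = α₂ f and h = α₃ g.  Then g x = f x − max f̂(y) over y ⋖ x, and
-- splitting off the first element of a saturated chain gives
-- h x = g x + max ĥ(y) over y ⋗ x, where ĥ(1̂) = 0.  When x is toggled, the
-- elements below x still carry f and those above x already carry 1 − h, so
-- the new value is
--   max f̂(y) + min (1 − ĥ(z)) − f x = 1 − (g x + max ĥ(z)) = 1 − h x,
-- with y ⋖ x ⋖ z.  That g lies in the chain polytope follows from
-- g x ≤ f x − f̂(y) for all y < x, which telescopes along chains.
module Submission where

open import Defs
open import Data.List.Base using (List)
open import Data.Product.Base using (_×_)
open import Relation.Unary using (_∈_)
open FinitePoset using (Carrier)

open import Algebra.Bundles using (CommutativeMonoid)
import Algebra.Properties.CommutativeSemigroup as CommutativeSemigroup
open import Data.Empty using (⊥-elim)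
open import Data.List.Base using ([]; _∷_; _++_; map; filter; length)
import Data.List.Membership.Propositional as List
open import Data.List.Membership.Propositional.Properties
  using (∈-map⁺; ∈-map⁻; ∈-filter⁺; ∈-filter⁻; ∈-concatMap⁺)
import Data.List.Properties as List
open import Data.List.Relation.Unary.All as All using ([]; _∷_)
open import Data.List.Relation.Unary.AllPairs as AllPairs using (AllPairs; []; _∷_)
import Data.List.Relation.Unary.AllPairs.Properties as AllPairs
open import Data.List.Relation.Unary.Any as Any using (here; there)
open import Data.List.Relation.Unary.Linked as Linked using (Linked; []; [-]; _∷_)
open import Data.List.Relation.Unary.Linked.Properties using (Linked⇒AllPairs)
open import Data.List.Relation.Unary.Unique.Propositional using (Unique)
import Data.Nat.Base as ℕ
open ℕ using (ℕ; zero; suc; z≤n; s≤s)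
import Data.Nat.Properties as ℕ
open import Data.Product.Base using (∃-syntax; _,_; proj₁; proj₂)
import Data.Rational.Base as ℚ
open ℚ using (0ℚ; ½)
import Data.Rational.Properties as ℚ
open import Data.Rational.Solver using (module +-*-Solver)
open import Data.Sum.Base using (_⊎_; inj₁; inj₂)
open import Function.Base using (flip)
open import Induction.WellFounded using (Acc; acc; WellFounded)
open import Level using (0ℓ)
open import Relation.Binary.Bundles using (Poset)
import Relation.Binary.Construct.Add.Extrema.Strict as AddExtrema
import Relation.Binary.Construct.NonStrictToStrict as ToStrict
open import Relation.Binary.Core using (Rel)
open import Relation.Binary.Definitions using (Asymmetric; Decidable; Transitive)
open import Relation.Binary.PropositionalEquality
  using (_≡_; _≢_; refl; sym; trans; cong; subst)
import Relation.Binary.Reasoning.PartialOrder as PosetReasoning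
open import Relation.Binary.Structures using (IsDecPartialOrder)
open import Relation.Nullary using (¬_; Dec; yes; no; ¬?)
open import Relation.Nullary.Construct.Add.Extrema using (⊥±; ⊤±; [_])
import Relation.Unary as Unary

-- Order and arithmetic of the Cauchy reals.

both-eventually : ∀ {A B : ℕ → Set} →
  ∃[ N ] (∀ n → N ℕ.≤ n → A n) → ∃[ N ] (∀ n → N ℕ.≤ n → B n) →
  ∃[ N ] (∀ n → N ℕ.≤ n → A n × B n)
both-eventually (M , p) (N , q) = M ℕ.⊔ N , λ n k →
  p n (ℕ.m⊔n≤o⇒m≤o M N k) , q n (ℕ.m⊔n≤o⇒n≤o M N k)

eventually-map : ∀ {A B : ℕ → Set} → (∀ n → A n → B n) →
  ∃[ N ] (∀ n → N ℕ.≤ n → A n) → ∃[ N ] (∀ n → N ℕ.≤ n → B n)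
eventually-map f (N , p) = N , λ n k → f n (p n k)

p≤p+ε : ∀ p {ε} → 0ℚ ℚ.< ε → p ℚ.≤ p ℚ.+ ε
p≤p+ε p {ε} 0<ε =
  subst (ℚ._≤ p ℚ.+ ε) (ℚ.+-identityʳ p) (ℚ.+-monoʳ-≤ p (ℚ.<⇒≤ 0<ε))

½*ε+½*ε≡ε : ∀ ε → ½ ℚ.* ε ℚ.+ ½ ℚ.* ε ≡ ε
½*ε+½*ε≡ε ε = trans (sym (ℚ.*-distribʳ-+ ε ½ ½)) (ℚ.*-identityˡ ε)

termwise⇒≤ : ∀ {x y} → (∀ n → seq x n ℚ.≤ seq y n) → x ≤ y
termwise⇒≤ {y = y} h = mk≤ λ ε 0<ε → 0 , λ n _ → ℚ.≤-trans (h n) (p≤p+ε (seq y n) 0<ε)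

≤-trans : Transitive _≤_
≤-trans {x} {y} {z} (mk≤ h) (mk≤ k) = mk≤ λ ε 0<ε →
  eventually-map
    (λ n (p , q) → ℚ.≤-trans p
      (subst (seq y n ℚ.+ ½ ℚ.* ε ℚ.≤_)
        (trans (ℚ.+-assoc (seq z n) _ _) (cong (seq z n ℚ.+_) (½*ε+½*ε≡ε ε)))
        (ℚ.+-monoˡ-≤ (½ ℚ.* ε) q)))
    (both-eventually (h _ (0<½*ε 0<ε)) (k _ (0<½*ε 0<ε)))

≃⇒≤ : ∀ {x y} → x ≃ y → x ≤ y
≃⇒≤ {x} {y} (mk≃ h) = mk≤ λ ε 0<ε →
  eventually-map (λ n → ∣p-q∣≤ε⇒p≤q+ε (seq x n) (seq y n)) (h ε 0<ε)

≃⇒≥ : ∀ {x y} → x ≃ y → y ≤ x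
≃⇒≥ {x} {y} (mk≃ h) = mk≤ λ ε 0<ε →
  eventually-map (λ n → ∣p-q∣≤ε⇒q≤p+ε (seq x n) (seq y n)) (h ε 0<ε)

≤-antisym : ∀ {x y} → x ≤ y → y ≤ x → x ≃ y
≤-antisym {x} {y} (mk≤ h) (mk≤ k) = mk≃ λ ε 0<ε →
  eventually-map (λ n (p , q) → ≤+ε⇒∣p-q∣≤ε (seq x n) (seq y n) p q)
    (both-eventually (h ε 0<ε) (k ε 0<ε))

≤-refl : ∀ {x} → x ≤ x
≤-refl = termwise⇒≤ λ n → ℚ.≤-refl

-- Reduces identities between reals to identities in `ℚ`, where the ring solver applies.
termwise⇒≃ : ∀ {x y} → (∀ n → seq x n ≡ seq y n) → x ≃ y
termwise⇒≃ h = ≤-antisym (termwise⇒≤ λ n → ℚ.≤-reflexive (h n))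
                         (termwise⇒≤ λ n → ℚ.≤-reflexive (sym (h n)))

≃-refl : ∀ {x} → x ≃ x
≃-refl = ≤-antisym ≤-refl ≤-refl

≃-sym : ∀ {x y} → x ≃ y → y ≃ x
≃-sym h = ≤-antisym (≃⇒≥ h) (≃⇒≤ h)

≃-trans : ∀ {x y z} → x ≃ y → y ≃ z → x ≃ z
≃-trans h k = ≤-antisym (≤-trans (≃⇒≤ h) (≃⇒≤ k)) (≤-trans (≃⇒≥ k) (≃⇒≥ h))

ℝ-poset : Poset 0ℓ 0ℓ 0ℓ
ℝ-poset = record
  { _≈_ = _≃_
  ; _≤_ = _≤_
  ; isPartialOrder = record
    { isPreorder = record
      { isEquivalence = record { refl = ≃-refl ; sym = ≃-sym ; trans = ≃-trans }
      ; reflexive     = ≃⇒≤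
      ; trans         = ≤-trans
      }
    ; antisym = ≤-antisym
    }
  }

open PosetReasoning ℝ-poset

infixl 6 _⊞_ _⊟_

-- Unfolding x + y exposes the moduli of convergence, and comparing those
-- makes conversion checking explode; hence these opaque copies of + and −.
opaque
  _⊞_ _⊟_ : ℝ → ℝ → ℝ
  x ⊞ y = x + y
  x ⊟ y = x - y

  ⊞⊟≃+- : ∀ x y z → x ⊞ y ⊟ z ≃ x + y - z
  ⊞⊟≃+- x y z = termwise⇒≃ λ n → refl

  ⊟≃- : ∀ x y → x ⊟ y ≃ x - y
  ⊟≃- x y = termwise⇒≃ λ n → refl

  ⊞-mono-≤ : ∀ {x y z w} → x ≤ y → z ≤ w → x ⊞ z ≤ y ⊞ w
  ⊞-mono-≤ {x} {y} {z} {w} (mk≤ h) (mk≤ k) = mk≤ λ ε 0<ε →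
    eventually-map
      (λ n (p , q) → subst (seq x n ℚ.+ seq z n ℚ.≤_)
        (trans (interchange (seq y n) _ (seq w n) _)
          (cong (seq y n ℚ.+ seq w n ℚ.+_) (½*ε+½*ε≡ε ε)))
        (ℚ.+-mono-≤ p q))
      (both-eventually (h _ (0<½*ε 0<ε)) (k _ (0<½*ε 0<ε)))
    where open CommutativeSemigroup (CommutativeMonoid.commutativeSemigroup ℚ.+-0-commutativeMonoid)
            using (interchange)

  neg-antimono-≤ : ∀ {x y} → x ≤ y → - y ≤ - x
  neg-antimono-≤ {x} {y} (mk≤ h) = mk≤ λ ε 0<ε →
    eventually-map
      (λ n p → subst (ℚ._≤ ℚ.- seq x n ℚ.+ ε)
        (solve 2 (λ b e → :- (b :+ e) :+ e := :- b) refl (seq y n) ε)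
        (ℚ.+-monoˡ-≤ ε (ℚ.neg-antimono-≤ p)))
      (h ε 0<ε)
    where open +-*-Solver

  ⊟-mono-≤ : ∀ {x y z w} → x ≤ y → w ≤ z → x ⊟ z ≤ y ⊟ w
  ⊟-mono-≤ {x} {y} {z} {w} h k =
    ⊞-mono-≤ {x} {y} { - z} { - w} h (neg-antimono-≤ {w} {z} k)

  ⊞-identityˡ : ∀ x → 0ℝ ⊞ x ≃ x
  ⊞-identityˡ x = termwise⇒≃ λ n → ℚ.+-identityˡ (seq x n)

  ⊞-identityʳ : ∀ x → x ⊞ 0ℝ ≃ x
  ⊞-identityʳ x = termwise⇒≃ λ n → ℚ.+-identityʳ (seq x n)

  x⊟0≃x : ∀ x → x ⊟ 0ℝ ≃ x
  x⊟0≃x x = termwise⇒≃ λ n → ℚ.+-identityʳ (seq x n)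

  x⊟x≃0 : ∀ x → x ⊟ x ≃ 0ℝ
  x⊟x≃0 x = termwise⇒≃ λ n → ℚ.+-inverseʳ (seq x n)

module _ where
  open +-*-Solver

  opaque
    unfolding _⊞_

    x⊟[x⊟y]≃y : ∀ x y → x ⊟ (x ⊟ y) ≃ y
    x⊟[x⊟y]≃y x y = termwise⇒≃ λ n →
      solve 2 (λ a b → a :- (a :- b) := b) refl (seq x n) (seq y n)

    x⊞[y⊟x]≃y : ∀ x y → x ⊞ (y ⊟ x) ≃ y
    x⊞[y⊟x]≃y x y = termwise⇒≃ λ n →
      solve 2 (λ a b → a :+ (b :- a) := b) refl (seq x n) (seq y n)

    x⊞y⊟x≃y : ∀ x y → x ⊞ y ⊟ x ≃ y
    x⊞y⊟x≃y x y = termwise⇒≃ λ n →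
      solve 2 (λ a b → (a :+ b) :- a := b) refl (seq x n) (seq y n)

    x⊞[y⊞z]≃[x⊞y]⊞z : ∀ x y z → x ⊞ (y ⊞ z) ≃ (x ⊞ y) ⊞ z
    x⊞[y⊞z]≃[x⊞y]⊞z x y z = termwise⇒≃ λ n →
      solve 3 (λ a b c → a :+ (b :+ c) := (a :+ b) :+ c) refl (seq x n) (seq y n) (seq z n)

    x⊞[y⊞z]≃y⊞[x⊞z] : ∀ x y z → x ⊞ (y ⊞ z) ≃ y ⊞ (x ⊞ z)
    x⊞[y⊞z]≃y⊞[x⊞z] x y z = termwise⇒≃ λ n →
      solve 3 (λ a b c → a :+ (b :+ c) := b :+ (a :+ c)) refl (seq x n) (seq y n) (seq z n)

    x⊞[y⊞z]⊞w≃[y⊞x]⊞[z⊞w] : ∀ x y z w → x ⊞ (y ⊞ z) ⊞ w ≃ (y ⊞ x) ⊞ (z ⊞ w)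
    x⊞[y⊞z]⊞w≃[y⊞x]⊞[z⊞w] x y z w = termwise⇒≃ λ n →
      solve 4 (λ a b c d → (a :+ (b :+ c)) :+ d := (b :+ a) :+ (c :+ d)) refl
        (seq x n) (seq y n) (seq z n) (seq w n)

    [x⊟y]⊞[z⊟x]≃z⊟y : ∀ x y z → (x ⊟ y) ⊞ (z ⊟ x) ≃ z ⊟ y
    [x⊟y]⊞[z⊟x]≃z⊟y x y z = termwise⇒≃ λ n →
      solve 3 (λ a b c → (a :- b) :+ (c :- a) := c :- b) refl (seq x n) (seq y n) (seq z n)

    x⊞[y⊟z]⊟w≃y⊟[w⊟x⊞z] : ∀ x y z w → x ⊞ (y ⊟ z) ⊟ w ≃ y ⊟ (w ⊟ x ⊞ z)
    x⊞[y⊟z]⊟w≃y⊟[w⊟x⊞z] x y z w = termwise⇒≃ λ n →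
      solve 4 (λ a b c d → (a :+ (b :- c)) :- d := b :- ((d :- a) :+ c)) refl
        (seq x n) (seq y n) (seq z n) (seq w n)

⊞-cong : ∀ {x y z w} → x ≃ y → z ≃ w → x ⊞ z ≃ y ⊞ w
⊞-cong h k = ≤-antisym (⊞-mono-≤ (≃⇒≤ h) (≃⇒≤ k)) (⊞-mono-≤ (≃⇒≥ h) (≃⇒≥ k))

⊟-cong : ∀ {x y z w} → x ≃ y → z ≃ w → x ⊟ z ≃ y ⊟ w
⊟-cong h k = ≤-antisym (⊟-mono-≤ (≃⇒≤ h) (≃⇒≥ k)) (⊟-mono-≤ (≃⇒≥ h) (≃⇒≤ k))

-- Subtraction from `y` reverses the order and is its own inverse.
x≤y⊟z⇒z≤y⊟x : ∀ {x y z} → x ≤ y ⊟ z → z ≤ y ⊟ x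
x≤y⊟z⇒z≤y⊟x {x} {y} {z} h = begin
  z            ≈⟨ x⊟[x⊟y]≃y y z ⟨
  y ⊟ (y ⊟ z)  ≤⟨ ⊟-mono-≤ ≤-refl h ⟩
  y ⊟ x        ∎

x≤y⇒0≤y⊟x : ∀ {x y} → x ≤ y → 0ℝ ≤ y ⊟ x
x≤y⇒0≤y⊟x {x} {y} h = begin
  0ℝ     ≈⟨ x⊟x≃0 x ⟨
  x ⊟ x  ≤⟨ ⊟-mono-≤ h ≤-refl ⟩
  y ⊟ x  ∎

x≤y⊞x : ∀ {x y} → 0ℝ ≤ y → x ≤ y ⊞ x
x≤y⊞x {x} {y} h = begin
  x       ≈⟨ ⊞-identityˡ x ⟨
  0ℝ ⊞ x  ≤⟨ ⊞-mono-≤ h ≤-refl ⟩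
  y ⊞ x   ∎

⊔-lub : ∀ {x y z} → x ≤ z → y ≤ z → x ⊔ y ≤ z
⊔-lub (mk≤ h) (mk≤ k) = mk≤ λ ε 0<ε →
  eventually-map (λ n (p , q) → ℚ.⊔-lub p q) (both-eventually (h ε 0<ε) (k ε 0<ε))

⊓-glb : ∀ {x y z} → z ≤ x → z ≤ y → z ≤ x ⊓ y
⊓-glb {x} {y} {z} (mk≤ h) (mk≤ k) = mk≤ λ ε 0<ε →
  eventually-map
    -- Taking `z` for both arguments on the left of `⊓-lip` yields a bound on `z ⊓ z` with the same
    -- slack `ε`; idempotence turns it into a bound on `z`.
    (λ n (p , q) → subst (ℚ._≤ seq (x ⊓ y) n ℚ.+ ε) (ℚ.⊓-idem (seq z n))
      (⊓-lip (seq z n) (seq z n) (seq x n) (seq y n) p q))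
    (both-eventually (h ε 0<ε) (k ε 0<ε))

x≤x⊔y : ∀ x y → x ≤ x ⊔ y
x≤x⊔y x y = termwise⇒≤ λ n → ℚ.p≤p⊔q (seq x n) (seq y n)

y≤x⊔y : ∀ x y → y ≤ x ⊔ y
y≤x⊔y x y = termwise⇒≤ λ n → ℚ.p≤q⊔p (seq x n) (seq y n)

x⊓y≤x : ∀ x y → x ⊓ y ≤ x
x⊓y≤x x y = termwise⇒≤ λ n → ℚ.p⊓q≤p (seq x n) (seq y n)

x⊓y≤y : ∀ x y → x ⊓ y ≤ y
x⊓y≤y x y = termwise⇒≤ λ n → ℚ.p⊓q≤q (seq x n) (seq y n)

-- Maxima, minima and sums over lists.

module _ {A : Set} (u : A → ℝ) where

  ≤-maximum : ∀ {a} xs → a List.∈ xs → u a ≤ maximum (map u xs)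
  ≤-maximum (x ∷ [])     (here refl) = ≤-refl
  ≤-maximum (x ∷ y ∷ xs) (here refl) = x≤x⊔y (u x) (maximum (map u (y ∷ xs)))
  ≤-maximum (x ∷ y ∷ xs) (there a∈)  =
    ≤-trans (≤-maximum (y ∷ xs) a∈) (y≤x⊔y (u x) (maximum (map u (y ∷ xs))))

  -- The membership of `a` excludes the empty list, where `maximum` takes its dummy value.
  maximum-≤ : ∀ {a z} xs → a List.∈ xs → (∀ {b} → b List.∈ xs → u b ≤ z) →
              maximum (map u xs) ≤ z
  maximum-≤ (x ∷ [])     a∈ h = h (here refl)
  maximum-≤ (x ∷ y ∷ xs) a∈ h =
    ⊔-lub {u x} {maximum (map u (y ∷ xs))} (h (here refl))
      (maximum-≤ (y ∷ xs) (here refl) (λ b∈ → h (there b∈)))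

  minimum-≤ : ∀ {a} xs → a List.∈ xs → minimum (map u xs) ≤ u a
  minimum-≤ (x ∷ [])     (here refl) = ≤-refl
  minimum-≤ (x ∷ y ∷ xs) (here refl) = x⊓y≤x (u x) (minimum (map u (y ∷ xs)))
  minimum-≤ (x ∷ y ∷ xs) (there a∈)  =
    ≤-trans (x⊓y≤y (u x) (minimum (map u (y ∷ xs)))) (minimum-≤ (y ∷ xs) a∈)

  ≤-minimum : ∀ {a z} xs → a List.∈ xs → (∀ {b} → b List.∈ xs → z ≤ u b) →
              z ≤ minimum (map u xs)
  ≤-minimum (x ∷ [])     a∈ h = h (here refl)
  ≤-minimum (x ∷ y ∷ xs) a∈ h =
    ⊓-glb {u x} {minimum (map u (y ∷ xs))} (h (here refl))
      (≤-minimum (y ∷ xs) (here refl) (λ b∈ → h (there b∈)))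

  -- The sum rebuilt from the opaque `⊞`, which keeps the moduli of convergence folded.
  weight : List A → ℝ
  weight []       = 0ℝ
  weight (x ∷ xs) = u x ⊞ weight xs

  opaque
    unfolding _⊞_

    ⊞≃sum : ∀ x xs → u x ⊞ sum (map u xs) ≃ sum (map u (x ∷ xs))
    ⊞≃sum x xs = termwise⇒≃ λ n → refl

  weight≃sum : ∀ xs → weight xs ≃ sum (map u xs)
  weight≃sum []       = ≃-refl
  weight≃sum (x ∷ xs) = begin-equality
    u x ⊞ weight xs        ≈⟨ ⊞-cong ≃-refl (weight≃sum xs) ⟩
    u x ⊞ sum (map u xs)   ≈⟨ ⊞≃sum x xs ⟩
    sum (map u (x ∷ xs))   ∎

  weight-nonneg : (∀ a → 0ℝ ≤ u a) → ∀ xs → 0ℝ ≤ weight xs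
  weight-nonneg 0≤u []       = ≤-refl
  weight-nonneg 0≤u (x ∷ xs) = ≤-trans (weight-nonneg 0≤u xs) (x≤y⊞x (0≤u x))

  weight-filter : ∀ {Q : Unary.Pred A 0ℓ} (Q? : Unary.Decidable Q) xs →
    weight xs ≃ weight (filter Q? xs) ⊞ weight (filter (λ a → ¬? (Q? a)) xs)
  weight-filter Q? []       = ≃-sym (⊞-identityˡ 0ℝ)
  weight-filter Q? (x ∷ xs) with Q? x
  ... | yes _ = ≃-trans (⊞-cong ≃-refl (weight-filter Q? xs)) (x⊞[y⊞z]≃[x⊞y]⊞z _ _ _)
  ... | no _  = ≃-trans (⊞-cong ≃-refl (weight-filter Q? xs)) (x⊞[y⊞z]≃y⊞[x⊞z] _ _ _)

module _ {A : Set} {u v : A → ℝ} where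

  maximum-cong : ∀ {a} xs → a List.∈ xs → (∀ {b} → b List.∈ xs → u b ≃ v b) →
                 maximum (map u xs) ≃ maximum (map v xs)
  maximum-cong xs a∈ h = ≤-antisym
    (maximum-≤ u xs a∈ λ b∈ → ≤-trans (≃⇒≤ (h b∈)) (≤-maximum v xs b∈))
    (maximum-≤ v xs a∈ λ b∈ → ≤-trans (≃⇒≥ (h b∈)) (≤-maximum u xs b∈))

  minimum-cong : ∀ {a} xs → a List.∈ xs → (∀ {b} → b List.∈ xs → u b ≃ v b) →
                 minimum (map u xs) ≃ minimum (map v xs)
  minimum-cong xs a∈ h = ≤-antisym
    (≤-minimum v xs a∈ λ b∈ → ≤-trans (minimum-≤ u xs b∈) (≃⇒≤ (h b∈)))
    (≤-minimum u xs a∈ λ b∈ → ≤-trans (minimum-≤ v xs b∈) (≃⇒≥ (h b∈)))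

-- Subtraction from `c` is antitone, so it exchanges minima and maxima. This serves twice: to write
-- `α₂` as `f` minus a maximum, and to evaluate the minimum in a toggle.
minimum-⊟ : ∀ {A : Set} {u : A → ℝ} {a} c xs → a List.∈ xs →
  minimum (map (λ b → c ⊟ u b) xs) ≃ c ⊟ maximum (map u xs)
minimum-⊟ {u = u} c xs a∈ = ≤-antisym
  (x≤y⊟z⇒z≤y⊟x (maximum-≤ u xs a∈ λ b∈ → x≤y⊟z⇒z≤y⊟x (minimum-≤ _ xs b∈)))
  (≤-minimum _ xs a∈ λ b∈ → ⊟-mono-≤ ≤-refl (≤-maximum u xs b∈))

-- Finding covers by scanning a finite list.

module _ {A : Set} {_<_ : Rel A 0ℓ} (<-trans : Transitive _<_)
         (<-asym : Asymmetric _<_) (_<?_ : Decidable _<_) where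

  -- Scanning xs and replacing a by each candidate in (a , b) ends at an
  -- element c with no candidate in (c , b): one skipped earlier would lie
  -- above the value of a at that time.
  approach : ∀ xs {a b} → a < b →
    ∃[ c ] (a ≡ c ⊎ a < c) × c < b × (∀ {z} → z List.∈ xs → ¬ (c < z × z < b))
  approach []       {a}     a<b = a , inj₁ refl , a<b , λ ()
  approach (x ∷ xs) {a} {b} a<b with a <? x | x <? b
  ... | yes a<x | yes x<b with approach xs x<b
  ...   | c , x≤c , c<b , none = c , inj₂ (a<c x≤c) , c<b , none′ x≤c
    where
    a<c : x ≡ c ⊎ x < c → a < c
    a<c (inj₁ refl) = a<x
    a<c (inj₂ x<c)  = <-trans a<x x<c
    none′ : x ≡ c ⊎ x < c → ∀ {z} → z List.∈ x ∷ xs → ¬ (c < z × z < b)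
    none′ (inj₁ refl) (here refl) (x<x , _) = <-asym x<x x<x
    none′ (inj₂ x<c)  (here refl) (c<x , _) = <-asym x<c c<x
    none′ _           (there z∈)  p         = none z∈ p
  approach (x ∷ xs) {a} {b} a<b | yes a<x | no x≮b with approach xs a<b
  ...   | c , a≤c , c<b , none = c , a≤c , c<b , λ
    { (here refl) (_ , x<b) → x≮b x<b
    ; (there z∈)  p         → none z∈ p }
  approach (x ∷ xs) {a} {b} a<b | no a≮x | _ with approach xs a<b
  ...   | c , a≤c , c<b , none = c , a≤c , c<b , λ
    { (here refl) (c<x , _) → a≮x (a<x a≤c c<x)
    ; (there z∈)  p         → none z∈ p }
    where
    a<x : a ≡ c ⊎ a < c → c < x → a < x
    a<x (inj₁ refl) c<x = c<x
    a<x (inj₂ a<c)  c<x = <-trans a<c c<x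

-- Covers and upward induction in a finite poset.

module _ (P : FinitePoset) where
  open FinitePoset P hiding (Carrier)
  open IsDecPartialOrder isDecPartialOrder using (isPartialOrder; antisym)

  private
    Elt : Set
    Elt = Carrier P
    open AddExtrema (_⊏_ P) using (_<±_; ⊥±<[_]; [_]; ⊥±<⊤±; [_]<⊤±; <±-trans; <±-asym)

    infix 4 _≺_ _⋖ᴾ_
    _≺_ : Rel Elt 0ℓ
    _≺_ = _⊏_ P
    _⋖ᴾ_ : Rel (P̂ P) 0ℓ
    _⋖ᴾ_ = _⋖_ P

  ≺-trans : Transitive _≺_
  ≺-trans = ToStrict.<-trans _≡_ _⊑_ isPartialOrder

  ≺-asym : Asymmetric _≺_
  ≺-asym = ToStrict.<-asym _≡_ _⊑_ antisym

  _≺?_ : Decidable _≺_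
  _≺?_ = ToStrict.<-decidable _≡_ _⊑_ _≟_ _⊑?_

  ≮⊥± : ∀ {a} → ¬ (a <± ⊥±)
  ≮⊥± {⊥±}    a<⊥ = <±-asym ≺-asym a<⊥ a<⊥
  ≮⊥± {[ x ]} a<⊥ = <±-asym ≺-asym a<⊥ ⊥±<[ x ]
  ≮⊥± {⊤±}    a<⊥ = <±-asym ≺-asym a<⊥ ⊥±<⊤±

  ∃-lowerCover : ∀ {a b} → a <± b → ∃[ c ] (a ≡ c ⊎ a <± c) × c List.∈ lowerCovers P b
  ∃-lowerCover a<b with approach (<±-trans ≺-trans) (<±-asym ≺-asym) (_<±?_ P) (P̂-elements P) a<b
  ... | c , a≤c , c<b , none = c , a≤c ,
    ∈-filter⁺ (λ y → _⋖?_ P y _) (P̂-enumerates P c)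
      (c<b , λ (z , c<z<b) → none (P̂-enumerates P z) c<z<b)

  -- In the opposite order the scan of `approach` starts at `b` and descends to a cover of `a`.
  ∃-upperCover : ∀ {a b} → a <± b → ∃[ c ] (b ≡ c ⊎ c <± b) × c List.∈ upperCovers P a
  ∃-upperCover a<b with approach {_<_ = flip _<±_} (flip (<±-trans ≺-trans)) (<±-asym ≺-asym)
                          (flip (_<±?_ P)) (P̂-elements P) a<b
  ... | c , c≤b , a<c , none = c , c≤b ,
    ∈-filter⁺ (λ y → _⋖?_ P _ y) (P̂-enumerates P c)
      (a<c , λ (z , a<z , z<c) → none (P̂-enumerates P z) (z<c , a<z))

  lowerCover-⋖ : ∀ x {y} → y List.∈ lowerCovers P x → y ⋖ᴾ x
  lowerCover-⋖ x y∈ = proj₂ (∈-filter⁻ (λ y → _⋖?_ P y x) {xs = P̂-elements P} y∈)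

  upperCover-⋖ : ∀ x {y} → y List.∈ upperCovers P x → x ⋖ᴾ y
  upperCover-⋖ x y∈ = proj₂ (∈-filter⁻ (λ y → _⋖?_ P x y) {xs = P̂-elements P} y∈)

  ⋖-upperCover : ∀ {x y} → x ⋖ᴾ y → y List.∈ upperCovers P x
  ⋖-upperCover {x} x⋖y = ∈-filter⁺ (λ y → _⋖?_ P x y) (P̂-enumerates P _) x⋖y

  -- The entry `y` itself is in `xs` but is not strictly above `y`, so the filter drops it. The
  -- length of such a list is the measure for climbing in the poset.
  above-shrinks : ∀ {x} xs → (∀ {z} → x ≺ z → z List.∈ xs) → ∀ {y} → x ≺ y →
    length (filter (y ≺?_) xs) ℕ.< length xs ×
    (∀ {z} → y ≺ z → z List.∈ filter (y ≺?_) xs)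
  above-shrinks xs above {y} x≺y =
    List.filter-notAll (y ≺?_) xs
      (Any.map (λ { refl y≺y → ≺-asym y≺y y≺y }) (above x≺y)) ,
    λ y≺z → ∈-filter⁺ (y ≺?_) (above (≺-trans x≺y y≺z)) y≺z

  -- Each step up shortens the list of candidates above the current element. The bound `n` on its
  -- length makes the recursion structural.
  ≻-wellFounded : WellFounded (flip _≺_)
  ≻-wellFounded x = go _ elements ℕ.≤-refl (λ _ → enumerates _)
    where
    go : ∀ n {x} xs → length xs ℕ.≤ n → (∀ {z} → x ≺ z → z List.∈ xs) → Acc (flip _≺_) x
    go zero    [] _  above = acc λ x≺y → ⊥-elim (absurd (above x≺y))
      where
      absurd : ∀ {y} → ¬ (y List.∈ [])
      absurd ()
    go (suc n) xs le above = acc λ {y} x≺y →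
      let lt , above′ = above-shrinks xs above x≺y
      in go n (filter (y ≺?_) xs) (ℕ.≤-pred (ℕ.≤-trans lt le)) above′

  -- Saturated chains up to the top.

  IsSaturated : List Elt → Set
  IsSaturated ys = Linked _⋖ᴾ_ (map [_] ys ++ ⊤± ∷ [])

  [⋖]⇒≺ : ∀ {x y} → [ x ] ⋖ᴾ [ y ] → x ≺ y
  [⋖]⇒≺ ([ x≺y ] , _) = x≺y

  -- Every cover step uses up an entry of the list of elements above. With `elements` for `xs`, the
  -- length bound in `saturatedChains` therefore excludes no saturated chain.
  saturated-length : ∀ {x} ys xs → IsSaturated (x ∷ ys) → (∀ {z} → x ≺ z → z List.∈ xs) →
                     length ys ℕ.≤ length xs
  saturated-length []       xs _           _     = z≤n
  saturated-length (y ∷ ys) xs (x⋖y ∷ sat) above =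
    let lt , above′ = above-shrinks xs above ([⋖]⇒≺ x⋖y)
    in ℕ.≤-trans (s≤s (saturated-length ys _ sat above′)) lt

  ∈-listsUpTo : ∀ n ys → length ys ℕ.≤ n → ys List.∈ listsUpTo P n
  ∈-listsUpTo zero    []       _        = here refl
  ∈-listsUpTo (suc n) []       _        = here refl
  ∈-listsUpTo (suc n) (y ∷ ys) (s≤s le) =
    there (∈-concatMap⁺ (λ x → map (x ∷_) (listsUpTo P n))
      (Any.map (λ { refl → ∈-map⁺ (y ∷_) (∈-listsUpTo n ys le) }) (enumerates y)))

  ∈-saturatedChains⁺ : ∀ {x ys} → IsSaturated (x ∷ ys) → (x ∷ ys) List.∈ saturatedChains P x
  ∈-saturatedChains⁺ {x} {ys} sat =
    ∈-filter⁺ (λ ys → Linked.linked? (_⋖?_ P) (map [_] ys ++ ⊤± ∷ []))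
      (∈-map⁺ (x ∷_) (∈-listsUpTo _ ys (saturated-length ys elements sat (λ _ → enumerates _))))
      sat

  saturatedChains-saturated : ∀ x {zs} → zs List.∈ saturatedChains P x → IsSaturated zs
  saturatedChains-saturated x zs∈ =
    proj₂ (∈-filter⁻ (λ ys → Linked.linked? (_⋖?_ P) (map [_] ys ++ ⊤± ∷ []))
      {xs = map (x ∷_) (listsUpTo P (length elements))} zs∈)

  ∈-saturatedChains⁻ : ∀ {x zs} → zs List.∈ saturatedChains P x →
                       ∃[ ys ] zs ≡ x ∷ ys × IsSaturated (x ∷ ys)
  ∈-saturatedChains⁻ {x} zs∈
    with ∈-map⁻ (x ∷_) (proj₁ (∈-filter⁻ (λ ys → Linked.linked? (_⋖?_ P) (map [_] ys ++ ⊤± ∷ []))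
           {xs = map (x ∷_) (listsUpTo P (length elements))} zs∈))
  ... | ys , _ , refl = ys , refl , saturatedChains-saturated x zs∈

  -- Transitivity turns consecutive covers into pairwise `≺`, whose two components give
  -- comparability and distinctness.
  saturated⇒chain : ∀ {ys} → IsSaturated ys → IsChain P ys
  saturated⇒chain sat =
    AllPairs.map proj₂ ≺-pairs , AllPairs.map (λ x≺y → inj₁ (proj₁ x≺y)) ≺-pairs
    where
    linked : ∀ ys → IsSaturated ys → Linked _≺_ ys
    linked []           _           = []
    linked (y ∷ [])     _           = [-]
    linked (x ∷ y ∷ ys) (x⋖y ∷ sat) = [⋖]⇒≺ x⋖y ∷ linked (y ∷ ys) sat
    ≺-pairs : AllPairs _≺_ _
    ≺-pairs = Linked⇒AllPairs ≺-trans (linked _ sat)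

  -- Choosing upper covers repeatedly must end at `⊤±` by well-foundedness. Hence the maximum in
  -- `α₃` is over a nonempty list.
  ∃-saturated : ∀ x → Acc (flip _≺_) x → ∃[ ys ] IsSaturated (x ∷ ys)
  ∃-saturated x (acc rec) with ∃-upperCover [ x ]<⊤±
  ... | c , _ , c∈ with upperCover-⋖ [ x ] c∈
  ∃-saturated x (acc rec) | ⊤± , _ | x⋖c = [] , x⋖c ∷ [-]
  ∃-saturated x (acc rec) | [ y ] , _ | x⋖y =
    let ys , sat = ∃-saturated y (rec ([⋖]⇒≺ x⋖y))
    in y ∷ ys , x⋖y ∷ sat
  ∃-saturated x (acc rec) | ⊥± , _ | x<⊥ , _ = ⊥-elim (≮⊥± x<⊥)

  ∃-∈-saturatedChains : ∀ x → ∃[ zs ] zs List.∈ saturatedChains P x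
  ∃-∈-saturatedChains x = _ , ∈-saturatedChains⁺ (proj₂ (∃-saturated x (≻-wellFounded x)))

  -- The recursion for `α₃` and its order reversal.

  module _ (g : Elt → ℝ) where

    private
      Σg : List Elt → ℝ
      Σg = weight g

    -- The value at 0̂ is never used.
    α̂₃ : P̂ P → ℝ
    α̂₃ ⊥±    = 0ℝ
    α̂₃ [ x ] = maximum (map Σg (saturatedChains P x))
    α̂₃ ⊤±    = 0ℝ

    α₃≃α̂₃ : ∀ x → α₃ P g x ≃ α̂₃ [ x ]
    α₃≃α̂₃ x = maximum-cong (saturatedChains P x) (proj₂ (∃-∈-saturatedChains x))
      λ {ys} _ → ≃-sym (weight≃sum g ys)

    α₁∘α₃≃ : ∀ x → α₁ P (α₃ P g) x ≃ 1ℝ ⊟ α̂₃ [ x ]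
    α₁∘α₃≃ x = begin-equality
      α₁ P (α₃ P g) x  ≈⟨ ⊟≃- 1ℝ (α₃ P g x) ⟨
      1ℝ ⊟ α₃ P g x    ≈⟨ ⊟-cong ≃-refl (α₃≃α̂₃ x) ⟩
      1ℝ ⊟ α̂₃ [ x ]    ∎

    -- Removing the head `x` leaves either the empty chain, when `⊤±` covers `x`, or a saturated
    -- chain from an upper cover of `x`; both passages are reversible.
    α̂₃-recursion : ∀ x → α̂₃ [ x ] ≃ g x ⊞ maximum (map α̂₃ (upperCovers P [ x ]))
    α̂₃-recursion x = ≤-antisym
      (maximum-≤ Σg (saturatedChains P x) (proj₂ (∃-∈-saturatedChains x)) upper)
      (begin
        -- Bounding the maximum `H` means bounding each of its entries, so `g x` is first moved to
        -- the other side.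
        g x ⊞ H                ≤⟨ ⊞-mono-≤ ≤-refl H≤ ⟩
        g x ⊞ (α̂₃ [ x ] ⊟ g x) ≈⟨ x⊞[y⊟x]≃y (g x) (α̂₃ [ x ]) ⟩
        α̂₃ [ x ]               ∎)
      where
      H : ℝ
      H = maximum (map α̂₃ (upperCovers P [ x ]))

      tail≤H : ∀ ys → IsSaturated (x ∷ ys) → Σg ys ≤ H
      -- The empty tail weighs `0ℝ`, which is the value of `α̂₃` at `⊤±`.
      tail≤H []       (x⋖1̂ ∷ _)   = ≤-maximum α̂₃ (upperCovers P [ x ]) (⋖-upperCover x⋖1̂)
      tail≤H (y ∷ ys) (x⋖y ∷ sat) = ≤-trans
        (≤-maximum Σg (saturatedChains P y) (∈-saturatedChains⁺ sat))
        (≤-maximum α̂₃ (upperCovers P [ x ]) (⋖-upperCover x⋖y))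

      upper : ∀ {zs} → zs List.∈ saturatedChains P x → Σg zs ≤ g x ⊞ H
      upper zs∈ with ∈-saturatedChains⁻ zs∈
      ... | ys , refl , sat = ⊞-mono-≤ ≤-refl (tail≤H ys sat)

      tail≤ : ∀ ys → IsSaturated (x ∷ ys) → Σg ys ≤ α̂₃ [ x ] ⊟ g x
      tail≤ ys sat = begin
        Σg ys             ≈⟨ x⊞y⊟x≃y (g x) (Σg ys) ⟨
        g x ⊞ Σg ys ⊟ g x ≤⟨ ⊟-mono-≤
          (≤-maximum Σg (saturatedChains P x) (∈-saturatedChains⁺ sat)) ≤-refl ⟩
        α̂₃ [ x ] ⊟ g x    ∎

      cover≤ : ∀ c → [ x ] ⋖ᴾ c → α̂₃ c ≤ α̂₃ [ x ] ⊟ g x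
      cover≤ ⊥±    (x<⊥ , _) = ⊥-elim (≮⊥± x<⊥)
      cover≤ ⊤±    x⋖1̂ = tail≤ [] (x⋖1̂ ∷ [-])
      cover≤ [ y ] x⋖y = maximum-≤ Σg (saturatedChains P y)
        (proj₂ (∃-∈-saturatedChains y)) chain≤
        where
        chain≤ : ∀ {zs} → zs List.∈ saturatedChains P y → Σg zs ≤ α̂₃ [ x ] ⊟ g x
        chain≤ zs∈ with ∈-saturatedChains⁻ zs∈
        ... | ys , refl , sat = tail≤ (y ∷ ys) (x⋖y ∷ sat)

      H≤ : H ≤ α̂₃ [ x ] ⊟ g x
      H≤ = maximum-≤ α̂₃ (upperCovers P [ x ]) (proj₂ (proj₂ (∃-upperCover [ x ]<⊤±)))
             (λ {c} c∈ → cover≤ c (upperCover-⋖ [ x ] c∈))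

    -- Saturated chains are chains, which gives the bound by one. Across a cover, the recursion adds
    -- a nonnegative `g x`; general comparisons follow by climbing through covers.
    α₃-orderReversing : ChainPolytope P g → OrderReversing P (α₃ P g)
    α₃-orderReversing (unit , chain≤1) = (λ x → 0≤α₃ x , α₃≤1 x) , reversing
      where
      0≤α₃ : ∀ x → 0ℝ ≤ α₃ P g x
      0≤α₃ x = begin
        0ℝ        ≤⟨ weight-nonneg g (λ y → proj₁ (unit y)) zs ⟩
        Σg zs     ≤⟨ ≤-maximum Σg (saturatedChains P x) zs∈ ⟩
        α̂₃ [ x ]  ≈⟨ α₃≃α̂₃ x ⟨
        α₃ P g x  ∎
        where
        zs : List Elt
        zs = proj₁ (∃-∈-saturatedChains x)
        zs∈ : zs List.∈ saturatedChains P x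
        zs∈ = proj₂ (∃-∈-saturatedChains x)

      Σg≤1 : ∀ C → IsChain P C → Σg C ≤ 1ℝ
      Σg≤1 C chain = ≤-trans (≃⇒≤ (weight≃sum g C)) (chain≤1 C chain)

      saturated≤1 : ∀ {x zs} → zs List.∈ saturatedChains P x → Σg zs ≤ 1ℝ
      saturated≤1 {x} {zs} zs∈ =
        Σg≤1 zs (saturated⇒chain {zs} (saturatedChains-saturated x zs∈))

      α₃≤1 : ∀ x → α₃ P g x ≤ 1ℝ
      α₃≤1 x = ≤-trans (≃⇒≤ (α₃≃α̂₃ x))
        (maximum-≤ Σg (saturatedChains P x) (proj₂ (∃-∈-saturatedChains x)) saturated≤1)

      cover-reversing : ∀ x c → c List.∈ upperCovers P [ x ] → α̂₃ c ≤ α̂₃ [ x ]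
      cover-reversing x c c∈ = begin
        α̂₃ c                                         ≤⟨ ≤-maximum α̂₃ (upperCovers P [ x ]) c∈ ⟩
        maximum (map α̂₃ (upperCovers P [ x ]))       ≤⟨ x≤y⊞x (proj₁ (unit x)) ⟩
        g x ⊞ maximum (map α̂₃ (upperCovers P [ x ])) ≈⟨ α̂₃-recursion x ⟨
        α̂₃ [ x ]                                     ∎

      strictly-reversing : ∀ {x y} → Acc (flip _≺_) x → x ≺ y → α̂₃ [ y ] ≤ α̂₃ [ x ]
      strictly-reversing {x} {y} (acc rec) x≺y = through (∃-upperCover [ x≺y ])
        where
        through : ∃[ c ] ([ y ] ≡ c ⊎ c <± [ y ]) × c List.∈ upperCovers P [ x ] →
                  α̂₃ [ y ] ≤ α̂₃ [ x ]
        through (_     , inj₁ refl    , y∈) = cover-reversing x [ y ] y∈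
        through ([ z ] , inj₂ [ z≺y ] , z∈) = ≤-trans
          (strictly-reversing (rec ([⋖]⇒≺ (upperCover-⋖ [ x ] z∈))) z≺y)
          (cover-reversing x [ z ] z∈)
        through (⊥±    , inj₂ _       , c∈) = ⊥-elim (≮⊥± (proj₁ (upperCover-⋖ [ x ] c∈)))

      reversing : ∀ {x y} → x ⊑ y → α₃ P g y ≤ α₃ P g x
      reversing {x} {y} x⊑y = begin
        α₃ P g y  ≈⟨ α₃≃α̂₃ y ⟩
        α̂₃ [ y ]  ≤⟨ weakly-reversing (x ≟ y) ⟩
        α̂₃ [ x ]  ≈⟨ α₃≃α̂₃ x ⟨
        α₃ P g x  ∎
        where
        weakly-reversing : Dec (x ≡ y) → α̂₃ [ y ] ≤ α̂₃ [ x ]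
        weakly-reversing (yes refl) = ≤-refl
        weakly-reversing (no x≢y)   = strictly-reversing (≻-wellFounded x) (x⊑y , x≢y)

  -- The map `α₂` into the chain polytope.

  module _ (f : Elt → ℝ) where

    private
      f̂ : P̂ P → ℝ
      f̂ = hat P f

    -- α₂ f extended by the same formula to 1̂; at 0̂ it takes the dummy value.
    α̂₂ : P̂ P → ℝ
    α̂₂ b = minimum (map (λ y → f̂ b ⊟ f̂ y) (lowerCovers P b))

    α₂≃α̂₂ : ∀ x → α₂ P f x ≃ α̂₂ [ x ]
    α₂≃α̂₂ x = minimum-cong {u = λ y → hat P f [ x ] - hat P f y} {v = λ y → f̂ [ x ] ⊟ f̂ y}
      (lowerCovers P [ x ]) (proj₂ (proj₂ (∃-lowerCover ⊥±<[ x ])))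
      λ {y} _ → ≃-sym (⊟≃- (hat P f [ x ]) (hat P f y))

  module _ (f : Elt → ℝ) (f∈ : OrderPolytope P f) where

    private
      f̂ : P̂ P → ℝ
      f̂ = hat P f

    hat-mono : ∀ {a b} → a <± b → f̂ a ≤ f̂ b
    hat-mono ⊥±<[ x ]        = proj₁ (proj₁ f∈ x)
    hat-mono [ (x⊑y , _) ]   = proj₂ f∈ x⊑y
    hat-mono ⊥±<⊤±           = termwise⇒≤ λ n → ℚ.nonNegative⁻¹ ℚ.1ℚ
    hat-mono [ x ]<⊤±        = proj₂ (proj₁ f∈ x)

    -- Some lower cover of `b` is at or above `a`, and `f̂` is monotone. This passes from covers to
    -- arbitrary pairs, as needed for chains that are not saturated.
    α̂₂-≤ : ∀ {a b} → a <± b → α̂₂ f b ≤ f̂ b ⊟ f̂ a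
    α̂₂-≤ {a} {b} a<b = through (∃-lowerCover a<b)
      where
      mono : ∀ {c} → a ≡ c ⊎ a <± c → f̂ a ≤ f̂ c
      mono (inj₁ refl) = ≤-refl
      mono (inj₂ a<c)  = hat-mono a<c
      through : ∃[ c ] (a ≡ c ⊎ a <± c) × c List.∈ lowerCovers P b → α̂₂ f b ≤ f̂ b ⊟ f̂ a
      through (c , a≤c , c∈) = ≤-trans (minimum-≤ (λ y → f̂ b ⊟ f̂ y) (lowerCovers P b) c∈)
        (⊟-mono-≤ ≤-refl (mono a≤c))

    -- The element `a` below `b` ensures that the minimum is over a nonempty list of lower covers.
    0≤α̂₂ : ∀ {a b} → a <± b → 0ℝ ≤ α̂₂ f b
    0≤α̂₂ {b = b} a<b = ≤-minimum (λ y → f̂ b ⊟ f̂ y) (lowerCovers P b) (proj₂ (proj₂ (∃-lowerCover a<b)))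
      λ c∈ → x≤y⇒0≤y⊟x (hat-mono (proj₁ (lowerCover-⋖ b c∈)))

    private
      Σα₂ : List Elt → ℝ
      Σα₂ = weight (α₂ P f)

      Comparable : Rel Elt 0ℓ
      Comparable x y = x ≺ y ⊎ y ≺ x

    -- Quicksort: the first element c splits the rest of the chain into a
    -- part in (a , c) and a part in (c , b), and the two bounds telescope.
    α̂₂-telescope : ∀ n C → length C ℕ.≤ n → AllPairs Comparable C → ∀ {a b} → a <± b →
      (∀ {c} → c List.∈ C → a <± [ c ] × [ c ] <± b) →
      Σα₂ C ⊞ α̂₂ f b ≤ f̂ b ⊟ f̂ a
    α̂₂-telescope _ [] _ _ {a} {b} a<b _ = begin
      0ℝ ⊞ α̂₂ f b  ≈⟨ ⊞-identityˡ (α̂₂ f b) ⟩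
      α̂₂ f b       ≤⟨ α̂₂-≤ a<b ⟩
      f̂ b ⊟ f̂ a    ∎
    α̂₂-telescope (suc n) (c ∷ C) (s≤s le) (c~C ∷ ~C) {a} {b} a<b between = begin
      α₂ P f c ⊞ Σα₂ C ⊞ α̂₂ f b
        ≈⟨ ⊞-cong (⊞-cong (α₂≃α̂₂ f c) (weight-filter (α₂ P f) (_≺? c) C)) ≃-refl ⟩
      α̂₂ f [ c ] ⊞ (Σα₂ L ⊞ Σα₂ U) ⊞ α̂₂ f b
        ≈⟨ x⊞[y⊞z]⊞w≃[y⊞x]⊞[z⊞w] (α̂₂ f [ c ]) (Σα₂ L) (Σα₂ U) (α̂₂ f b) ⟩
      (Σα₂ L ⊞ α̂₂ f [ c ]) ⊞ (Σα₂ U ⊞ α̂₂ f b)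
        ≤⟨ ⊞-mono-≤
             (α̂₂-telescope n L (ℕ.≤-trans (List.length-filter _ C) le)
               (AllPairs.filter⁺ (_≺? c) ~C) a<c L-between)
             (α̂₂-telescope n U (ℕ.≤-trans (List.length-filter _ C) le)
               (AllPairs.filter⁺ (λ x → ¬? (x ≺? c)) ~C) c<b U-between) ⟩
      (f̂ [ c ] ⊟ f̂ a) ⊞ (f̂ b ⊟ f̂ [ c ])
        ≈⟨ [x⊟y]⊞[z⊟x]≃z⊟y (f c) (f̂ a) (f̂ b) ⟩
      f̂ b ⊟ f̂ a ∎
      where
      L U : List Elt
      L = filter (_≺? c) C
      U = filter (λ x → ¬? (x ≺? c)) C
      a<c : a <± [ c ]
      a<c = proj₁ (between (here refl))
      c<b : [ c ] <± b
      c<b = proj₂ (between (here refl))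
      L-between : ∀ {x} → x List.∈ L → a <± [ x ] × [ x ] <± [ c ]
      L-between x∈ =
        let x∈C , x≺c = ∈-filter⁻ (_≺? c) {xs = C} x∈
        in proj₁ (between (there x∈C)) , [ x≺c ]
      U-between : ∀ {x} → x List.∈ U → [ c ] <± [ x ] × [ x ] <± b
      U-between {x} x∈ =
        let x∈C , x⊀c = ∈-filter⁻ (λ x → ¬? (x ≺? c)) {xs = C} x∈
        in c<x x⊀c (All.lookup c~C x∈C) , proj₂ (between (there x∈C))
        where
        c<x : ¬ (x ≺ c) → Comparable c x → [ c ] <± [ x ]
        c<x _   (inj₁ c≺x) = [ c≺x ]
        c<x x⊀c (inj₂ x≺c) = ⊥-elim (x⊀c x≺c)

    α₂-chainPolytope : ChainPolytope P (α₂ P f)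
    α₂-chainPolytope = (λ x → ≤-trans (0≤α̂₂ ⊥±<[ x ]) (≃⇒≥ (α₂≃α̂₂ f x)) , α₂≤1 x) , chain≤1
      where
      α₂≤1 : ∀ x → α₂ P f x ≤ 1ℝ
      α₂≤1 x = begin
        α₂ P f x    ≈⟨ α₂≃α̂₂ f x ⟩
        α̂₂ f [ x ]  ≤⟨ α̂₂-≤ ⊥±<[ x ] ⟩
        f x ⊟ 0ℝ    ≈⟨ x⊟0≃x (f x) ⟩
        f x         ≤⟨ proj₂ (proj₁ f∈ x) ⟩
        1ℝ          ∎

      chain≤1 : ∀ C → IsChain P C → sum (map (α₂ P f) C) ≤ 1ℝ
      chain≤1 C (distinct , total) = begin
        sum (map (α₂ P f) C)  ≈⟨ weight≃sum (α₂ P f) C ⟨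
        Σα₂ C                 ≈⟨ ⊞-identityʳ _ ⟨
        -- The nonnegative term at `⊤±` is added so that the sum telescopes all the way from `⊥±` to
        -- `⊤±`.
        Σα₂ C ⊞ 0ℝ            ≤⟨ ⊞-mono-≤ ≤-refl (0≤α̂₂ ⊥±<⊤±) ⟩
        Σα₂ C ⊞ α̂₂ f ⊤±       ≤⟨ α̂₂-telescope (length C) C ℕ.≤-refl
          (AllPairs.zipWith comparable (distinct , total)) ⊥±<⊤±
          (λ {c} _ → ⊥±<[ c ] , [ c ]<⊤±) ⟩
        1ℝ ⊟ 0ℝ               ≈⟨ x⊟0≃x 1ℝ ⟩
        1ℝ                    ∎
        where
        comparable : ∀ {x y} → x ≢ y × (x ⊑ y ⊎ y ⊑ x) → Comparable x y
        comparable (x≢y , inj₁ x⊑y) = inj₁ (x⊑y , x≢y)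
        comparable (x≢y , inj₂ y⊑x) = inj₂ (y⊑x , λ y≡x → x≢y (sym y≡x))

  -- Toggles and rowmotion along a linear extension.

  toggle-≢ : ∀ {x y} f → y ≢ x → toggle P x f y ≡ f y
  toggle-≢ {x} {y} f y≢x with y ≟ x
  ... | yes y≡x = ⊥-elim (y≢x y≡x)
  ... | no _    = refl

  -- Opaque because the with-abstraction in toggle-≡ normalises its goal.
  opaque
    toggled-value : Elt → (Elt → ℝ) → ℝ
    toggled-value x f =
      maximum (map (hat P f) (lowerCovers P [ x ])) +
      minimum (map (hat P f) (upperCovers P [ x ])) - f x

    toggled-value-≡ : ∀ x f →
      maximum (map (hat P f) (lowerCovers P [ x ])) +
      minimum (map (hat P f) (upperCovers P [ x ])) - f x ≡ toggled-value x f
    toggled-value-≡ x f = refl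

    toggled-value-≃ : ∀ x f →
      toggled-value x f ≃
      maximum (map (hat P f) (lowerCovers P [ x ])) ⊞
      minimum (map (hat P f) (upperCovers P [ x ])) ⊟ f x
    toggled-value-≃ x f = ≃-sym (⊞⊟≃+-
      (maximum (map (hat P f) (lowerCovers P [ x ])))
      (minimum (map (hat P f) (upperCovers P [ x ]))) (f x))

  toggle-≡ : ∀ x f → toggle P x f x ≡ toggled-value x f
  toggle-≡ x f with x ≟ x
  ... | yes _  = toggled-value-≡ x f
  ... | no x≢x = ⊥-elim (x≢x refl)

  module _ (f r : Elt → ℝ) (r≃ : ∀ x → r x ≃ 1ℝ ⊟ α̂₃ (α₂ P f) [ x ]) where

    -- `ρ` toggles from the end of the list, so the elements already toggled form a suffix of the
    -- linear extension, which is an up-set.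
    UpClosed : List Elt → Set
    UpClosed zs = ∀ {y z} → y List.∈ zs → y ≺ z → z List.∈ zs

    -- The target `r` is kept abstract and known only through `r≃`. The hypotheses describe the
    -- moment at which `x` is toggled: everything above has its final value, while `x` and
    -- everything below are unchanged.
    toggle-rowmotion : ∀ x f′ → f′ x ≃ f x →
      (∀ {y} → y ≺ x → f′ y ≃ f y) → (∀ {y} → x ≺ y → f′ y ≃ r y) →
      toggle P x f′ x ≃ r x
    toggle-rowmotion x f′ at below above = begin-equality
      toggle P x f′ x
        ≡⟨ toggle-≡ x f′ ⟩
      toggled-value x f′
        ≈⟨ toggled-value-≃ x f′ ⟩
      maximum (map (hat P f′) lower) ⊞ minimum (map (hat P f′) upper) ⊟ f′ x
        ≈⟨ ⊟-cong (⊞-cong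
             (maximum-cong lower lower∈ λ y∈ → hat-below (proj₁ (lowerCover-⋖ [ x ] y∈)))
             (minimum-cong upper upper∈ λ y∈ → hat-above (proj₁ (upperCover-⋖ [ x ] y∈)))) at ⟩
      M ⊞ minimum (map (λ y → 1ℝ ⊟ α̂₃ g y) upper) ⊟ f x
        ≈⟨ ⊟-cong (⊞-cong ≃-refl (minimum-⊟ 1ℝ upper upper∈)) ≃-refl ⟩
      M ⊞ (1ℝ ⊟ H) ⊟ f x
        ≈⟨ x⊞[y⊟z]⊟w≃y⊟[w⊟x⊞z] M 1ℝ H (f x) ⟩
      1ℝ ⊟ (f x ⊟ M ⊞ H)
        -- By `minimum-⊟`, the difference `f x ⊟ M` is the value of `α₂` at `x`.
        ≈⟨ ⊟-cong ≃-refl (⊞-cong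
             (≃-trans (α₂≃α̂₂ f x) (minimum-⊟ (f x) lower lower∈)) ≃-refl) ⟨
      1ℝ ⊟ (g x ⊞ H)
        ≈⟨ ⊟-cong ≃-refl (α̂₃-recursion g x) ⟨
      1ℝ ⊟ α̂₃ g [ x ]
        ≈⟨ r≃ x ⟨
      r x ∎
      where
      g : Elt → ℝ
      g = α₂ P f
      lower upper : List (P̂ P)
      lower = lowerCovers P [ x ]
      upper = upperCovers P [ x ]
      M H : ℝ
      M = maximum (map (hat P f) lower)
      H = maximum (map (α̂₃ g) upper)
      lower∈ : _ List.∈ lower
      lower∈ = proj₂ (proj₂ (∃-lowerCover ⊥±<[ x ]))
      upper∈ : _ List.∈ upper
      upper∈ = proj₂ (proj₂ (∃-upperCover [ x ]<⊤±))
      hat-below : ∀ {y} → y <± [ x ] → hat P f′ y ≃ hat P f y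
      hat-below ⊥±<[ _ ]  = ≃-refl
      hat-below [ y≺x ]   = below y≺x
      hat-above : ∀ {y} → [ x ] <± y → hat P f′ y ≃ 1ℝ ⊟ α̂₃ g y
      hat-above {[ y ]} [ x≺y ] = ≃-trans (above x≺y) (r≃ y)
      -- Here the left side is `1ℝ`, and `α̂₃` vanishes at `⊤±`.
      hat-above [ _ ]<⊤±        = ≃-sym (x⊟0≃x 1ℝ)

    -- Induction on the suffix, with the invariant that toggled entries have their final values and
    -- all other elements still carry `f`. The head is toggled last, after everything above it.
    ρ-upClosed : ∀ zs → Unique zs → AllPairs (λ x y → ¬ (y ≺ x)) zs → UpClosed zs →
      (∀ {y} → y List.∈ zs → ρ P zs f y ≃ r y) ×
      (∀ {y} → ¬ (y List.∈ zs) → ρ P zs f y ≃ f y)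
    ρ-upClosed []       _          _            _  = (λ ()) , λ _ → ≃-refl
    ρ-upClosed (x ∷ zs) (x≢ ∷ zs!) (x⊁ ∷ sorted) up = toggled , untouched
      where
      up′ : UpClosed zs
      up′ y∈ y≺z with up (there y∈) y≺z
      -- If `z` were the head `x`, then `y`, a later entry, would lie below it, against the sorting.
      ... | here refl = ⊥-elim (All.lookup x⊁ y∈ y≺z)
      ... | there z∈  = z∈

      ih : (∀ {y} → y List.∈ zs → ρ P zs f y ≃ r y) ×
           (∀ {y} → ¬ (y List.∈ zs) → ρ P zs f y ≃ f y)
      ih = ρ-upClosed zs zs! sorted up′

      above : ∀ {y} → x ≺ y → ρ P zs f y ≃ r y
      above {y} x≺y = toggled-before (up (here refl) x≺y)
        where
        toggled-before : y List.∈ x ∷ zs → ρ P zs f y ≃ r y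
        toggled-before (here refl) = ⊥-elim (≺-asym x≺y x≺y)
        toggled-before (there y∈)  = proj₁ ih y∈

      toggled : ∀ {y} → y List.∈ x ∷ zs → toggle P x (ρ P zs f) y ≃ r y
      toggled (here refl) = toggle-rowmotion x (ρ P zs f)
        (proj₂ ih λ x∈ → All.lookup x≢ x∈ refl)
        -- No later entry lies below `x`, so the elements below it are still untouched.
        (λ y≺x → proj₂ ih λ y∈ → All.lookup x⊁ y∈ y≺x)
        above
      toggled {y} (there y∈) = begin-equality
        toggle P x (ρ P zs f) y ≡⟨ toggle-≢ (ρ P zs f) (λ { refl → All.lookup x≢ y∈ refl }) ⟩
        ρ P zs f y              ≈⟨ proj₁ ih y∈ ⟩
        r y                     ∎

      untouched : ∀ {y} → ¬ (y List.∈ x ∷ zs) → toggle P x (ρ P zs f) y ≃ f y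
      untouched {y} y∉ = begin-equality
        toggle P x (ρ P zs f) y ≡⟨ toggle-≢ (ρ P zs f) (λ y≡x → y∉ (here y≡x)) ⟩
        ρ P zs f y              ≈⟨ proj₂ ih (λ y∈ → y∉ (there y∈)) ⟩
        f y                     ∎

theorem2 : (P : FinitePoset) (f : Carrier P → ℝ) → f ∈ OrderPolytope P →
    α₂ P f ∈ ChainPolytope P ×
    α₃ P (α₂ P f) ∈ OrderReversing P ×
    (∀ (xs : List (Carrier P)) → IsLinearExtension P xs →
    ∀ x → ρ P xs f x ≃ α₁ P (α₃ P (α₂ P f)) x)
theorem2 P f f∈ =
  α₂-chainPolytope P f f∈ ,
  α₃-orderReversing P (α₂ P f) (α₂-chainPolytope P f f∈) ,
  λ xs (distinct , complete , sorted) x →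
    -- A linear extension contains every element, so the full list is an up-set and each `x` has
    -- been toggled.
    proj₁ (ρ-upClosed P f (α₁ P (α₃ P (α₂ P f))) (α₁∘α₃≃ P (α₂ P f))
      xs distinct sorted (λ _ _ → complete _)) (complete x)
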